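{- Let $r\ge 2$ and $m\ge 7$ be integers. Then for every integer $n\ge m-1$, $$F_{n+2^{m-6},r}\equiv F_{n,r}\pmod{2^m},$$ i.e. from the term of index $m-1$ onward the sequence $(F_{n,r}\bmod 2^m)_{n\ge0}$ is periodic with period $2^{m-6}$.
   Context: For positive integers $r\le m\le n$, $S_r(n,m)$ denotes the $r$-Stirling number of the second kind: the number of partitions of $\{1,\dots,n\}$ into $m$ non-empty blocks such that $1,\dots,r$ lie in pairwise distinct blocks. For a positive integer $r$ and integer $n\ge 0$, the $r$-Fubini number is $F_{n,r}=\sum_{k=0}^{n}(k+r)!\,S_r(n+r,k+r)$. -}

module Defs where

open import Data.Bool.Base using (true; false)
open import Data.Fin.Base using (Fin; toℕ)
import Data.Fin.Properties as Fin
open import Data.Fin.Subset using (Subset; _∈_; _∩_; Nonempty; Empty)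
open import Data.Fin.Subset.Properties using (_∈?_; nonempty?)
open import Data.Integer.Base as ℤ using (+_)
import Data.Integer.Divisibility as ℤ
open import Data.List.Base using (List; []; _∷_; _++_; map; length; filter; upTo)
open import Data.List.Relation.Unary.All as All using (All)
open import Data.List.Relation.Unary.AllPairs as AllPairs using (AllPairs)
open import Data.List.Relation.Unary.Any as Any using (Any)
open import Data.Nat.Base using (ℕ; zero; suc; _+_; _*_; _<_; _!)
open import Data.Nat.ListAction using (sum)
open import Data.Nat.Properties using (_≟_; _<?_)
open import Data.Product.Base using (_×_)
open import Data.Vec.Base using ([]; _∷_)
open import Relation.Binary.PropositionalEquality using (_≡_)
open import Relation.Nullary using (Dec; ¬?)
open import Relation.Nullary.Decidable using (_×-dec_; _→-dec_)

-- All subsets of Fin n, each listed exactly once.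
subsets : ∀ n → List (Subset n)
subsets zero    = [] ∷ []
subsets (suc n) = map (false ∷_) (subsets n) ++ map (true ∷_) (subsets n)

sublists : ∀ {a} {A : Set a} → List A → List (List A)
sublists []       = [] ∷ []
sublists (x ∷ xs) = sublists xs ++ map (x ∷_) (sublists xs)

-- All sets of subsets of Fin n.  As subsets n has no repetitions, each such set
-- occurs exactly once, as the list of its members in the order of subsets n.
families : ∀ n → List (List (Subset n))
families n = sublists (subsets n)

IsPartition : ∀ {n} → List (Subset n) → Set
IsPartition {n} P =
  All Nonempty P ×
  AllPairs (λ A B → Empty (A ∩ B)) P ×
  (∀ (i : Fin n) → Any (i ∈_) P)

-- The elements 1, …, r of {1, …, n} are those i : Fin n with toℕ i < r.
Separates : ∀ {n} → ℕ → List (Subset n) → Set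
Separates {n} r P =
  ∀ (i j : Fin n) → toℕ i < r → toℕ j < r → All (λ B → i ∈ B → j ∈ B → i ≡ j) P

IsStirlingPartition : ∀ {n} → ℕ → ℕ → List (Subset n) → Set
IsStirlingPartition r m P = IsPartition P × length P ≡ m × Separates r P

isPartition? : ∀ {n} (P : List (Subset n)) → Dec (IsPartition P)
isPartition? P =
  All.all? nonempty? P ×-dec
  AllPairs.allPairs? (λ A B → ¬? (nonempty? (A ∩ B))) P ×-dec
  Fin.all? (λ i → Any.any? (i ∈?_) P)

separates? : ∀ {n} r (P : List (Subset n)) → Dec (Separates r P)
separates? r P =
  Fin.all? λ i → Fin.all? λ j → (toℕ i <? r) →-dec ((toℕ j <? r) →-dec
    All.all? (λ B → (i ∈? B) →-dec ((j ∈? B) →-dec (i Fin.≟ j))) P)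

isStirlingPartition? : ∀ {n} r m (P : List (Subset n)) → Dec (IsStirlingPartition r m P)
isStirlingPartition? r m P = isPartition? P ×-dec (length P ≟ m) ×-dec separates? r P

-- stirling r n m is S_r(n,m).
stirling : ℕ → ℕ → ℕ → ℕ
stirling r n m = length (filter (isStirlingPartition? r m) (families n))

-- fubini n r is F_{n,r}.
fubini : ℕ → ℕ → ℕ
fubini n r = sum (map (λ k → (k + r) ! * stirling r (n + r) (k + r)) (upTo (suc n)))

infix 4 _≡_[mod_]

_≡_[mod_] : ℕ → ℕ → ℕ → Set
a ≡ b [mod d ] = + d ℤ.∣ + a ℤ.- + b

{-# OPTIONS --safe #-}
-- Removing the first element of a partition gives a recurrence for the r-Stirling numbers,
-- and from it F_{0,r} = r! and F_{n+1,r} = r F_{n,r} + F_{n,r+1}.  By linearity and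
-- telescoping it follows that, modulo 2^M,
--   F_{n,r} ≡ - Σ_{j=1}^{M} 2^(j-1) x^n x(x-1)⋯(x-r+1)   with x = -j.
-- For r = 2 the difference of two such sums is divisible by 2^m term by term: even x
-- contribute x^(n+1), with n + 1 ≥ m; for odd x, 2^(m-4) divides x^(2^(m-6)) - 1, and 2^4
-- divides 2^(j-1) x(x-1) unless x = -1, where x^(2^(m-6)) - 1 = 0.  The recurrence for F
-- carries the periodicity from r to r + 1.
module Submission where

open import Defs
open import Data.Bool.Base using (true; false; if_then_else_)
open import Data.Empty using (⊥-elim)
open import Data.Fin.Base using (Fin; toℕ; fromℕ<) renaming (zero to fzero; suc to fsuc)
import Data.Fin.Properties as Fin
open import Data.Fin.Subset using (Subset; _∈_; _∉_; _∩_; Nonempty; Empty)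
open import Data.Fin.Subset.Properties using (_∈?_; nonempty?; x∈p∩q⁺; x∈p∩q⁻; drop-there; drop-∷-Empty)
open import Data.List.Base using (List; []; _∷_; _++_; map; length; filter; upTo; [_])
open import Data.List.Properties using (map-++; map-∘; map-cong; length-map; map-applyUpTo; map-upTo; upTo-∷ʳ)
open import Data.List.Membership.Propositional using () renaming (_∈_ to _∈ᴸ_)
open import Data.List.Relation.Binary.Permutation.Propositional using (_↭_; prep; swap; ↭-refl; ↭-trans; ↭-sym; ↭⇒↭ₛ)
open import Data.List.Relation.Binary.Permutation.Propositional.Properties using (All-resp-↭; Any-resp-↭; ↭-length; ++-comm)
import Data.List.Relation.Binary.Permutation.Setoid.Properties as ↭ₛ
open import Data.List.Relation.Unary.All as All using (All; []; _∷_)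
import Data.List.Relation.Unary.All.Properties as All
open import Data.List.Relation.Unary.AllPairs as AllPairs using (AllPairs; []; _∷_)
import Data.List.Relation.Unary.AllPairs.Properties as AllPairs
open import Data.List.Relation.Unary.Any as Any using (Any; here; there)
import Data.List.Relation.Unary.Any.Properties as Any
open import Data.Nat.Base using (ℕ; zero; suc; pred; _+_; _*_; _∸_; _^_; _≤_; _<_; z≤n; s≤s; s<s; s<s⁻¹; z<s; _!)
open import Data.Nat.ListAction using (sum)
open import Data.Nat.ListAction.Properties using (sum-++)
open import Data.Nat.Properties
open import Data.Nat.Tactic.RingSolver using (solve-∀)
open import Data.Product.Base using (_×_; _,_; ∃-syntax)
open import Data.Sum.Base using (_⊎_; inj₁; inj₂)
open import Data.Vec.Base using ([]; _∷_; here; there)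
open import Function.Base using (_∘_)
open import Level using (Level)
open import Relation.Binary.Definitions using (Symmetric)
open import Relation.Binary.PropositionalEquality using (_≡_; refl; sym; trans; cong; cong₂; subst; setoid; resp₂; module ≡-Reasoning)
open import Relation.Nullary using (Dec; yes; no; does; ¬_; ¬?)
open import Relation.Nullary.Decidable using (_×-dec_; _→-dec_; dec-true; dec-false)

private
  variable
    a p q : Level
    A B : Set a
    P : Set p
    Q : Set q

-- Finite sums and indicators

∑ : List A → (A → ℕ) → ℕ
∑ xs f = sum (map f xs)

∑-cong : ∀ (xs : List A) {f g : A → ℕ} → (∀ x → f x ≡ g x) → ∑ xs f ≡ ∑ xs g
∑-cong xs f≗g = cong sum (map-cong f≗g xs)

∑-++ : ∀ (xs ys : List A) (f : A → ℕ) → ∑ (xs ++ ys) f ≡ ∑ xs f + ∑ ys f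
∑-++ xs ys f = trans (cong sum (map-++ f xs ys)) (sum-++ (map f xs) (map f ys))

∑-map : ∀ (h : A → B) xs (f : B → ℕ) → ∑ (map h xs) f ≡ ∑ xs (f ∘ h)
∑-map h xs f = cong sum (sym (map-∘ xs))

∑-zero : ∀ (xs : List A) {f : A → ℕ} → (∀ x → f x ≡ 0) → ∑ xs f ≡ 0
∑-zero []       f≡0 = refl
∑-zero (x ∷ xs) f≡0 = cong₂ _+_ (f≡0 x) (∑-zero xs f≡0)

+-interchange : ∀ a b c d → (a + b) + (c + d) ≡ (a + c) + (b + d)
+-interchange = solve-∀

∑-+ : ∀ (xs : List A) (f g : A → ℕ) → ∑ xs (λ x → f x + g x) ≡ ∑ xs f + ∑ xs g
∑-+ []       f g = refl
∑-+ (x ∷ xs) f g = trans (cong (f x + g x +_) (∑-+ xs f g)) (+-interchange (f x) (g x) _ _)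

∑-*ʳ : ∀ (xs : List A) (f : A → ℕ) c → ∑ xs (λ x → f x * c) ≡ ∑ xs f * c
∑-*ʳ []       f c = refl
∑-*ʳ (x ∷ xs) f c = trans (cong (f x * c +_) (∑-*ʳ xs f c)) (sym (*-distribʳ-+ c (f x) _))

∑-swap : ∀ (xs : List A) (ys : List B) (f : A → B → ℕ) →
         ∑ xs (λ x → ∑ ys (f x)) ≡ ∑ ys (λ y → ∑ xs (λ x → f x y))
∑-swap []       ys f = sym (∑-zero ys (λ _ → refl))
∑-swap (x ∷ xs) ys f = trans (cong (∑ ys (f x) +_) (∑-swap xs ys f)) (sym (∑-+ ys (f x) _))

𝟙 : Dec P → ℕ
𝟙 p? = if does p? then 1 else 0

𝟙-yes : (p? : Dec P) → P → 𝟙 p? ≡ 1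
𝟙-yes p? p = cong (if_then 1 else 0) (dec-true p? p)

𝟙-no : (p? : Dec P) → ¬ P → 𝟙 p? ≡ 0
𝟙-no p? ¬p = cong (if_then 1 else 0) (dec-false p? ¬p)

𝟙-cong : (p? : Dec P) (q? : Dec Q) → (P → Q) → (Q → P) → 𝟙 p? ≡ 𝟙 q?
𝟙-cong (yes p) q? to from = sym (𝟙-yes q? (to p))
𝟙-cong (no ¬p) q? to from = sym (𝟙-no q? (¬p ∘ from))

𝟙-× : (p? : Dec P) (q? : Dec Q) → 𝟙 (p? ×-dec q?) ≡ 𝟙 p? * 𝟙 q?
𝟙-× (yes _) q? = sym (*-identityˡ _)
𝟙-× (no _)  q? = refl

-- For replacing a factor by a value that is known only where the indicator is 1; elsewhere both
-- sides vanish.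
*-𝟙-subst : (p? : Dec P) {x y : ℕ} → (P → x ≡ y) → x * 𝟙 p? ≡ 𝟙 p? * y
*-𝟙-subst (yes p) {x} {y} x≡y = trans (*-identityʳ x) (trans (x≡y p) (sym (*-identityˡ y)))
*-𝟙-subst (no _)  {x}     x≡y = *-zeroʳ x

length-filter≡∑𝟙 : ∀ {P : A → Set p} (P? : ∀ x → Dec (P x)) xs →
                   length (filter P? xs) ≡ ∑ xs (𝟙 ∘ P?)
length-filter≡∑𝟙 P? []       = refl
length-filter≡∑𝟙 P? (x ∷ xs) with does (P? x)
... | true  = cong suc (length-filter≡∑𝟙 P? xs)
... | false = length-filter≡∑𝟙 P? xs

-- Sums over sublists

∑-sublists-∷ : ∀ x (xs : List A) (f : List A → ℕ) →
  ∑ (sublists (x ∷ xs)) f ≡ ∑ (sublists xs) f + ∑ (sublists xs) (f ∘ (x ∷_))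
∑-sublists-∷ x xs f = trans (∑-++ (sublists xs) _ f) (cong (∑ (sublists xs) f +_) (∑-map (x ∷_) (sublists xs) f))

-- Each sublist of `xs ++ ys` arises from exactly one pair `S`, `T`. This separates the blocks
-- without the element zero from those with it.
∑-sublists-++ : ∀ (xs ys : List A) (f : List A → ℕ) →
  ∑ (sublists (xs ++ ys)) f ≡ ∑ (sublists xs) (λ S → ∑ (sublists ys) (λ T → f (S ++ T)))
∑-sublists-++ []       ys f = sym (+-identityʳ _)
∑-sublists-++ (x ∷ xs) ys f = begin
  ∑ (sublists (x ∷ xs ++ ys)) f
    ≡⟨ ∑-sublists-∷ x (xs ++ ys) f ⟩
  ∑ (sublists (xs ++ ys)) f + ∑ (sublists (xs ++ ys)) (f ∘ (x ∷_))
    ≡⟨ cong₂ _+_ (∑-sublists-++ xs ys f) (∑-sublists-++ xs ys (f ∘ (x ∷_))) ⟩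
  ∑ (sublists xs) (λ S → ∑ (sublists ys) (λ T → f (S ++ T))) +
  ∑ (sublists xs) (λ S → ∑ (sublists ys) (λ T → f (x ∷ S ++ T)))
    ≡⟨ ∑-sublists-∷ x xs _ ⟨
  ∑ (sublists (x ∷ xs)) (λ S → ∑ (sublists ys) (λ T → f (S ++ T))) ∎
  where open ≡-Reasoning

∑-sublists-map : ∀ (h : A → B) xs (f : List B → ℕ) →
  ∑ (sublists (map h xs)) f ≡ ∑ (sublists xs) (f ∘ map h)
∑-sublists-map h []       f = refl
∑-sublists-map h (x ∷ xs) f = begin
  ∑ (sublists (h x ∷ map h xs)) f
    ≡⟨ ∑-sublists-∷ (h x) (map h xs) f ⟩
  ∑ (sublists (map h xs)) f + ∑ (sublists (map h xs)) (f ∘ (h x ∷_))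
    ≡⟨ cong₂ _+_ (∑-sublists-map h xs f) (∑-sublists-map h xs (f ∘ (h x ∷_))) ⟩
  ∑ (sublists xs) (f ∘ map h) + ∑ (sublists xs) (f ∘ map h ∘ (x ∷_))
    ≡⟨ ∑-sublists-∷ x xs (f ∘ map h) ⟨
  ∑ (sublists (x ∷ xs)) (f ∘ map h) ∎
  where open ≡-Reasoning

∑-sublists-[] : ∀ (xs : List A) {f : List A → ℕ} → (∀ x S → f (x ∷ S) ≡ 0) →
  ∑ (sublists xs) f ≡ f []
∑-sublists-[] []       {f} f≡0 = +-identityʳ (f [])
∑-sublists-[] (x ∷ xs) {f} f≡0 = begin
  ∑ (sublists (x ∷ xs)) f                             ≡⟨ ∑-sublists-∷ x xs f ⟩
  ∑ (sublists xs) f + ∑ (sublists xs) (f ∘ (x ∷_))    ≡⟨ cong₂ _+_ (∑-sublists-[] xs f≡0) (∑-zero (sublists xs) (f≡0 x)) ⟩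
  f [] + 0                                            ≡⟨ +-identityʳ (f []) ⟩
  f []                                                ∎
  where open ≡-Reasoning

-- Meant for the blocks that contain the element zero, of which a partition has exactly one.
∑-sublists-singletons : ∀ (xs : List A) {f : List A → ℕ} → f [] ≡ 0 → (∀ x y S → f (x ∷ y ∷ S) ≡ 0) →
  ∑ (sublists xs) f ≡ ∑ xs (λ x → f [ x ])
∑-sublists-singletons []       {f} f[]≡0 f≡0 = trans (+-identityʳ (f [])) f[]≡0
∑-sublists-singletons (x ∷ xs) {f} f[]≡0 f≡0 = begin
  ∑ (sublists (x ∷ xs)) f                             ≡⟨ ∑-sublists-∷ x xs f ⟩
  ∑ (sublists xs) f + ∑ (sublists xs) (f ∘ (x ∷_))    ≡⟨ cong₂ _+_ (∑-sublists-singletons xs f[]≡0 f≡0) (∑-sublists-[] xs (f≡0 x)) ⟩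
  ∑ xs (λ x → f [ x ]) + f [ x ]                      ≡⟨ +-comm _ (f [ x ]) ⟩
  f [ x ] + ∑ xs (λ x → f [ x ])                      ∎
  where open ≡-Reasoning

-- Sums `g y S′` over the ways to take one entry `y` out of `S`, where `S′` keeps the other entries
-- in order; the entries already passed are stored in the function argument.
∑-pick : (A → List A → ℕ) → List A → ℕ
∑-pick g []      = 0
∑-pick g (x ∷ S) = g x S + ∑-pick (λ y S′ → g y (x ∷ S′)) S

-- The factor `c` may depend on the whole list `S` but not on the entry taken out. It will be the
-- indicator that `S` is a partition, which reordering does not change.
∑-pick-factor : ∀ (S : List A) (g : A → List A → ℕ) c (w : A → ℕ) →
  (∀ y S′ → y ∷ S′ ↭ S → g y S′ ≡ w y * c) → ∑-pick g S ≡ ∑ S w * c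
∑-pick-factor []      g c w g≡ = refl
∑-pick-factor (x ∷ S) g c w g≡ = begin
  g x S + ∑-pick (λ y S′ → g y (x ∷ S′)) S
    ≡⟨ cong₂ _+_ (g≡ x S ↭-refl)
         (∑-pick-factor S _ c w (λ y S′ σ → g≡ y (x ∷ S′) (↭-trans (swap y x ↭-refl) (prep x σ)))) ⟩
  w x * c + ∑ S w * c ≡⟨ *-distribʳ-+ c (w x) (∑ S w) ⟨
  (w x + ∑ S w) * c   ∎
  where open ≡-Reasoning

-- Choosing y and a sublist S′ with y ∉ S′ amounts to choosing a sublist S together with
-- one of its members.
∑-sublists-pick : ∀ (xs : List A) (g : A → List A → ℕ) → (∀ y S → y ∈ᴸ S → g y S ≡ 0) →
  ∑ xs (λ y → ∑ (sublists xs) (g y)) ≡ ∑ (sublists xs) (∑-pick g)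
∑-sublists-pick []       g g≡0 = refl
∑-sublists-pick (x ∷ xs) g g≡0 = begin
  ∑ (sublists (x ∷ xs)) (g x) + ∑ xs (λ y → ∑ (sublists (x ∷ xs)) (g y))
    ≡⟨ cong₂ _+_ (trans (∑-sublists-∷ x xs (g x)) (cong (∑ subs (g x) +_) (∑-zero subs (λ S → g≡0 x (x ∷ S) (here refl)))))
         (∑-cong xs (λ y → ∑-sublists-∷ x xs (g y))) ⟩
  (∑ subs (g x) + 0) + ∑ xs (λ y → ∑ subs (g y) + ∑ subs (gx y))
    ≡⟨ cong (∑ subs (g x) + 0 +_) (∑-+ xs (λ y → ∑ subs (g y)) (λ y → ∑ subs (gx y))) ⟩
  (∑ subs (g x) + 0) + (∑ xs (λ y → ∑ subs (g y)) + ∑ xs (λ y → ∑ subs (gx y)))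
    ≡⟨ cong (∑ subs (g x) + 0 +_) (cong₂ _+_ (∑-sublists-pick xs g g≡0)
         (∑-sublists-pick xs gx (λ y S y∈S → g≡0 y (x ∷ S) (there y∈S)))) ⟩
  (∑ subs (g x) + 0) + (∑ subs (∑-pick g) + ∑ subs (∑-pick gx))
    ≡⟨ rearrange (∑ subs (g x)) (∑ subs (∑-pick g)) (∑ subs (∑-pick gx)) ⟩
  ∑ subs (∑-pick g) + (∑ subs (g x) + ∑ subs (∑-pick gx))
    ≡⟨ cong (∑ subs (∑-pick g) +_) (∑-+ subs (g x) (∑-pick gx)) ⟨
  ∑ subs (∑-pick g) + ∑ subs (∑-pick g ∘ (x ∷_))
    ≡⟨ ∑-sublists-∷ x xs (∑-pick g) ⟨
  ∑ (sublists (x ∷ xs)) (∑-pick g) ∎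
  where
  open ≡-Reasoning
  subs = sublists xs
  gx = λ y S → g y (x ∷ S)
  rearrange : ∀ a b c → (a + 0) + (b + c) ≡ b + (a + c)
  rearrange = solve-∀

-- Partitions

Disjoint : ∀ {n} → Subset n → Subset n → Set
Disjoint C D = Empty (C ∩ D)

Disjoint-sym : ∀ {n} → Symmetric (Disjoint {n})
Disjoint-sym {x = C} {D} C∩D=∅ (i , i∈D∩C) =
  let i∈D , i∈C = x∈p∩q⁻ D C i∈D∩C in C∩D=∅ (i , x∈p∩q⁺ (i∈C , i∈D))

disjoint : ∀ {n} {C D : Subset n} → (∀ {i} → i ∈ C → i ∉ D) → Disjoint C D
disjoint {C = C} {D} sep (i , i∈C∩D) = let i∈C , i∈D = x∈p∩q⁻ C D i∈C∩D in sep i∈C i∈D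

disjoint⁻ : ∀ {n} {C D : Subset n} → Disjoint C D → ∀ {i} → i ∈ C → i ∉ D
disjoint⁻ C∩D=∅ i∈C i∈D = C∩D=∅ (_ , x∈p∩q⁺ (i∈C , i∈D))

disjoint-∷ : ∀ {n} b {C D : Subset n} → Disjoint C D → Disjoint (b ∷ C) (false ∷ D)
disjoint-∷ b     C∥D (fsuc i , i∈C∩D) = C∥D (i , drop-there i∈C∩D)
disjoint-∷ true  C∥D (fzero , ())
disjoint-∷ false C∥D (fzero , ())

disjoint-∷⁻ : ∀ {n} b {C D : Subset n} → Disjoint (b ∷ C) (false ∷ D) → Disjoint C D
disjoint-∷⁻ b = drop-∷-Empty

Covers : ∀ {n} → List (Subset n) → Set
Covers S = ∀ i → Any (i ∈_) S

-- Families are lists in a fixed order; this invariance allows a chosen block to be moved to the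
-- front.
isStirlingPartition-resp-↭ : ∀ {n r m} {S T : List (Subset n)} → S ↭ T →
  IsStirlingPartition r m S → IsStirlingPartition r m T
isStirlingPartition-resp-↭ {n} σ ((nonempty , pairs , cover) , len , sep) =
  ( All-resp-↭ σ nonempty
  , ↭ₛ.AllPairs-resp-↭ (setoid (Subset n)) Disjoint-sym (resp₂ Disjoint) (↭⇒↭ₛ σ) pairs
  , λ i → Any-resp-↭ σ (cover i)) ,
  trans (sym (↭-length σ)) len ,
  λ i j i<r j<r → All-resp-↭ σ (sep i j i<r j<r)

-- Counting the blocks without distinguished elements

Avoids : ∀ {n} → ℕ → Subset n → Set
Avoids s C = ∀ i → toℕ i < s → i ∉ C

avoids? : ∀ {n} s (C : Subset n) → Dec (Avoids s C)
avoids? s C = Fin.all? λ i → (toℕ i <? s) →-dec ¬? (i ∈? C)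

-- Covering supplies one block through `i`, and disjointness excludes a second.
∑-∈ : ∀ {n} (S : List (Subset n)) i → AllPairs Disjoint S → Any (i ∈_) S → ∑ S (λ C → 𝟙 (i ∈? C)) ≡ 1
∑-∈ (C ∷ S) i (C∥S ∷ _) (here i∈C) = cong₂ _+_ (𝟙-yes (i ∈? C) i∈C) (rest S C∥S)
  where
  rest : ∀ S → All (Disjoint C) S → ∑ S (λ C → 𝟙 (i ∈? C)) ≡ 0
  rest []      []            = refl
  rest (D ∷ S) (C∥D ∷ C∥S) = cong₂ _+_ (𝟙-no (i ∈? D) (disjoint⁻ C∥D i∈C)) (rest S C∥S)
∑-∈ (C ∷ S) i (C∥S ∷ pairs) (there i∈S) =
  cong₂ _+_ (𝟙-no (i ∈? C) (λ i∈C → miss C∥S i∈S i∈C)) (∑-∈ S i pairs i∈S)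
  where
  miss : ∀ {S} → All (Disjoint C) S → Any (i ∈_) S → i ∉ C
  miss (C∥D ∷ _) (here i∈D) i∈C = disjoint⁻ C∥D i∈C i∈D
  miss (_ ∷ C∥S) (there i∈S)   = miss C∥S i∈S

-- The first `s` elements occupy `s` different blocks. By induction on `s`, each new element spoils
-- exactly one block among those that avoided its predecessors.
∑-avoids : ∀ {n} s (S : List (Subset n)) → s ≤ n → AllPairs Disjoint S → Covers S → Separates s S →
  ∑ S (λ C → 𝟙 (avoids? s C)) + s ≡ length S
∑-avoids zero    S _   _     _     _   = trans (+-identityʳ _) (all-avoid S)
  where
  all-avoid : ∀ S → ∑ S (λ C → 𝟙 (avoids? 0 C)) ≡ length S
  all-avoid []      = refl
  all-avoid (C ∷ S) = cong₂ _+_ (𝟙-yes (avoids? 0 C) (λ _ ())) (all-avoid S)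
∑-avoids {n} (suc s) S s<n pairs cover sep = begin
  ∑ S (λ C → 𝟙 (avoids? (suc s) C)) + suc s
    ≡⟨ +-suc (∑ S (λ C → 𝟙 (avoids? (suc s) C))) s ⟩
  1 + ∑ S (λ C → 𝟙 (avoids? (suc s) C)) + s
    ≡⟨ cong (λ t → t + ∑ S (λ C → 𝟙 (avoids? (suc s) C)) + s) (∑-∈ S i pairs (cover i)) ⟨
  ∑ S (λ C → 𝟙 (i ∈? C)) + ∑ S (λ C → 𝟙 (avoids? (suc s) C)) + s
    ≡⟨ cong (_+ s) (split S (λ j j<s → sep i j (≤-reflexive (cong suc toℕ-i)) (m<n⇒m<1+n j<s))) ⟨
  ∑ S (λ C → 𝟙 (avoids? s C)) + s
    ≡⟨ ∑-avoids s S (<⇒≤ s<n) pairs cover (λ j k j<s k<s → sep j k (m<n⇒m<1+n j<s) (m<n⇒m<1+n k<s)) ⟩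
  length S ∎
  where
  open ≡-Reasoning
  i : Fin n
  i = fromℕ< s<n

  toℕ-i : toℕ i ≡ s
  toℕ-i = Fin.toℕ-fromℕ< s<n

  avoids-suc : ∀ {C} → i ∉ C → Avoids s C → Avoids (suc s) C
  avoids-suc {C} i∉C av j j<1+s with m<1+n⇒m<n∨m≡n j<1+s
  ... | inj₁ j<s = av j j<s
  ... | inj₂ j≡s = subst (_∉ C) (Fin.toℕ-injective (trans toℕ-i (sym j≡s))) i∉C

  -- By separation, a block containing `i` avoids the first `s` elements, so it counts on the left
  -- and only in the first summand on the right.
  pointwise : ∀ C → (∀ j → toℕ j < s → i ∈ C → j ∈ C → i ≡ j) →
              𝟙 (avoids? s C) ≡ 𝟙 (i ∈? C) + 𝟙 (avoids? (suc s) C)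
  pointwise C sepC = helper (i ∈? C)
    where
    helper : (d : Dec (i ∈ C)) → 𝟙 (avoids? s C) ≡ 𝟙 d + 𝟙 (avoids? (suc s) C)
    helper (yes i∈C) = trans
      (𝟙-yes (avoids? s C) (λ j j<s j∈C → <-irrefl (trans (cong toℕ (sym (sepC j j<s i∈C j∈C))) toℕ-i) j<s))
      (cong suc (sym (𝟙-no (avoids? (suc s) C) (λ av → av i (≤-reflexive (cong suc toℕ-i)) i∈C))))
    helper (no i∉C) = 𝟙-cong (avoids? s C) (avoids? (suc s) C) (avoids-suc i∉C) (λ av j j<s → av j (m<n⇒m<1+n j<s))

  split : ∀ S → (∀ j → toℕ j < s → All (λ C → i ∈ C → j ∈ C → i ≡ j) S) →
          ∑ S (λ C → 𝟙 (avoids? s C)) ≡ ∑ S (λ C → 𝟙 (i ∈? C)) + ∑ S (λ C → 𝟙 (avoids? (suc s) C))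
  split []      _   = refl
  split (C ∷ S) sep = trans
    (cong₂ _+_ (pointwise C (λ j j<s → All.head (sep j j<s))) (split S (λ j j<s → All.tail (sep j j<s))))
    (+-interchange (𝟙 (i ∈? C)) _ _ _)

-- Shows that the case of zero forming a singleton block is counted once.
∑-subsets-empty : ∀ n → ∑ (subsets n) (λ C → 𝟙 (¬? (nonempty? C))) ≡ 1
∑-subsets-empty zero    = refl
∑-subsets-empty (suc n) = begin
  ∑ (subsets (suc n)) empty𝟙
    ≡⟨ ∑-++ (map (false ∷_) (subsets n)) _ empty𝟙 ⟩
  ∑ (map (false ∷_) (subsets n)) empty𝟙 + ∑ (map (true ∷_) (subsets n)) empty𝟙
    ≡⟨ cong₂ _+_ (∑-map (false ∷_) (subsets n) empty𝟙) (∑-map (true ∷_) (subsets n) empty𝟙) ⟩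
  ∑ (subsets n) (λ C → empty𝟙 (false ∷ C)) + ∑ (subsets n) (λ C → empty𝟙 (true ∷ C))
    ≡⟨ cong₂ _+_
         (∑-cong (subsets n) (λ C → 𝟙-cong (¬? (nonempty? (false ∷ C))) (¬? (nonempty? C)) drop-∷-Empty
           (λ { ¬C (fsuc i , there i∈C) → ¬C (i , i∈C) })))
         (∑-zero (subsets n) (λ C → 𝟙-no (¬? (nonempty? (true ∷ C))) (λ ¬C → ¬C (fzero , here)))) ⟩
  ∑ (subsets n) (λ C → 𝟙 (¬? (nonempty? C))) + 0
    ≡⟨ +-identityʳ _ ⟩
  ∑ (subsets n) (λ C → 𝟙 (¬? (nonempty? C)))
    ≡⟨ ∑-subsets-empty n ⟩
  1 ∎
  where
  open ≡-Reasoning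
  empty𝟙 : Subset (suc n) → ℕ
  empty𝟙 C = 𝟙 (¬? (nonempty? C))

-- Removing the element zero from a partition

-- What remains of a partition of Fin (suc n) when the element zero is removed from
-- its block, leaving C, which may be empty.
IsPunctured : ∀ {n} → ℕ → ℕ → Subset n → List (Subset n) → Set
IsPunctured s m C S =
  All Nonempty S × AllPairs Disjoint (C ∷ S) × Covers (C ∷ S) × length S ≡ m × Separates s (C ∷ S) × Avoids s C

punctured : ∀ {n} r m (C : Subset n) S →
  IsStirlingPartition r (suc m) ((true ∷ C) ∷ map (false ∷_) S) → IsPunctured (pred r) m C S
punctured r m C S ((_ ∷ nonempty , C∥S ∷ pairs , cover) , len , sep) =
  All.gmap⁻ (λ { (fsuc i , there i∈D) → i , i∈D }) nonempty ,
  (All.gmap⁻ (disjoint-∷⁻ true) C∥S ∷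
   AllPairs.map (disjoint-∷⁻ false) (AllPairs.map⁻ pairs)) ,
  (λ i → cover′ (cover (fsuc i))) ,
  trans (sym (length-map (false ∷_) S)) (suc-injective len) ,
  separates r sep ,
  avoids r sep
  where
  cover′ : ∀ {i} → Any (fsuc i ∈_) ((true ∷ C) ∷ map (false ∷_) S) → Any (i ∈_) (C ∷ S)
  cover′ (here i∈C)  = here (drop-there i∈C)
  cover′ (there i∈S) = there (Any.map drop-there (Any.map⁻ i∈S))

  separates : ∀ r → Separates r ((true ∷ C) ∷ map (false ∷_) S) → Separates (pred r) (C ∷ S)
  -- For `r = 0` also `pred r` is 0 and no index lies below the bound, so only the successor case
  -- remains.
  separates (suc s) sep i j i<s j<s with sep (fsuc i) (fsuc j) (s<s i<s) (s<s j<s)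
  ... | sepC ∷ sepS =
    (λ i∈C j∈C → Fin.suc-injective (sepC (there i∈C) (there j∈C))) ∷
    All.gmap⁻ (λ sepD i∈D j∈D → Fin.suc-injective (sepD (there i∈D) (there j∈D))) sepS

  avoids : ∀ r → Separates r ((true ∷ C) ∷ map (false ∷_) S) → Avoids (pred r) C
  -- A distinguished `i` in `C` would share its block with zero, which is distinguished too.
  avoids (suc s) sep i i<s i∈C with All.head (sep fzero (fsuc i) z<s (s<s i<s)) here (there i∈C)
  ... | ()

unpunctured : ∀ {n} r m (C : Subset n) S →
  IsPunctured (pred r) m C S → IsStirlingPartition r (suc m) ((true ∷ C) ∷ map (false ∷_) S)
unpunctured r m C S (nonempty , C∥S ∷ pairs , cover , len , sep , av) =
  ( (fzero , here) ∷ All.gmap⁺ (λ { (i , i∈D) → fsuc i , there i∈D }) nonempty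
  , All.gmap⁺ (disjoint-∷ true) C∥S ∷
    AllPairs.map⁺ (AllPairs.map (disjoint-∷ false) pairs)
  , cover′) ,
  cong suc (trans (length-map (false ∷_) S) len) ,
  separates r sep av
  where
  cover′ : Covers ((true ∷ C) ∷ map (false ∷_) S)
  cover′ fzero    = here here
  cover′ (fsuc i) with cover i
  ... | here i∈C  = here (there i∈C)
  ... | there i∈S = there (Any.map⁺ (Any.map there i∈S))

  separates : ∀ r → Separates (pred r) (C ∷ S) → Avoids (pred r) C → Separates r ((true ∷ C) ∷ map (false ∷_) S)
  separates (suc s) sep av fzero    fzero    _ _ = (λ _ _ → refl) ∷ All.map⁺ (All.universal (λ _ _ _ → refl) S)
  -- No block holds both elements: `C` avoids `j`, and the blocks from `S` lack zero.
  separates (suc s) sep av fzero    (fsuc j) _ j<r =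
    (λ { _ (there j∈C) → ⊥-elim (av j (s<s⁻¹ j<r) j∈C) }) ∷ All.map⁺ (All.universal (λ _ ()) S)
  separates (suc s) sep av (fsuc i) fzero    i<r _ =
    (λ { (there i∈C) _ → ⊥-elim (av i (s<s⁻¹ i<r) i∈C) }) ∷ All.map⁺ (All.universal (λ _ _ ()) S)
  separates (suc s) sep av (fsuc i) (fsuc j) i<r j<r with sep i j (s<s⁻¹ i<r) (s<s⁻¹ j<r)
  ... | sepC ∷ sepS =
    (λ { (there i∈C) (there j∈C) → cong fsuc (sepC i∈C j∈C) }) ∷
    All.gmap⁺ (λ { sepD (there i∈D) (there j∈D) → cong fsuc (sepD i∈D j∈D) }) sepS

-- If `C` is empty, zero was a singleton and `S` alone is a partition, while `C ∷ S` has an empty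
-- block. If `C` is nonempty, the first summand vanishes and `C ∷ S` is a partition whose block `C`
-- may take zero back.
𝟙-isStirlingPartition-∷ : ∀ {n} r m (C : Subset n) S →
  𝟙 (isStirlingPartition? r (suc m) ((true ∷ C) ∷ map (false ∷_) S)) ≡
  𝟙 (¬? (nonempty? C)) * 𝟙 (isStirlingPartition? (pred r) m S) +
  𝟙 (avoids? (pred r) C) * 𝟙 (isStirlingPartition? (pred r) (suc m) (C ∷ S))
𝟙-isStirlingPartition-∷ r m C S = by-cases (nonempty? C)
  where
  open ≡-Reasoning
  uncover : ∀ {i} → Empty C → Any (i ∈_) (C ∷ S) → Any (i ∈_) S
  uncover C=∅ (here i∈C)  = ⊥-elim (C=∅ (_ , i∈C))
  uncover C=∅ (there i∈S) = i∈S

  rearrange : ∀ a b → a ≡ 1 * a + b * 0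
  rearrange = solve-∀

  by-cases : (d : Dec (Nonempty C)) →
    𝟙 (isStirlingPartition? r (suc m) ((true ∷ C) ∷ map (false ∷_) S)) ≡
    𝟙 (¬? d) * 𝟙 (isStirlingPartition? (pred r) m S) +
    𝟙 (avoids? (pred r) C) * 𝟙 (isStirlingPartition? (pred r) (suc m) (C ∷ S))
  by-cases (yes C≠∅) = trans
    (𝟙-cong (isStirlingPartition? r (suc m) _) (avoids? (pred r) C ×-dec isStirlingPartition? (pred r) (suc m) (C ∷ S))
      (λ st → let nonempty , pairs , cover , len , sep , av = punctured r m C S st in
        av , (C≠∅ ∷ nonempty , pairs , cover) , cong suc len , sep)
      (λ { (av , (_ ∷ nonempty , pairs , cover) , len , sep) →
        unpunctured r m C S (nonempty , pairs , cover , suc-injective len , sep , av) }))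
    (𝟙-× (avoids? (pred r) C) (isStirlingPartition? (pred r) (suc m) (C ∷ S)))
  by-cases (no C=∅) = begin
    𝟙 (isStirlingPartition? r (suc m) ((true ∷ C) ∷ map (false ∷_) S))
      ≡⟨ 𝟙-cong (isStirlingPartition? r (suc m) _) (isStirlingPartition? (pred r) m S)
           (λ st → let nonempty , pairs , cover , len , sep , _ = punctured r m C S st in
             (nonempty , AllPairs.tail pairs , λ i → uncover C=∅ (cover i)) , len , λ i j i<s j<s → All.tail (sep i j i<s j<s))
           (λ { ((nonempty , pairs , cover) , len , sep) → unpunctured r m C S
             ( nonempty
             , All.universal (λ D → disjoint (λ i∈C _ → C=∅ (_ , i∈C))) S ∷ pairs
             , (λ i → there (cover i))
             , len
             , (λ i j i<s j<s → (λ i∈C _ → ⊥-elim (C=∅ (i , i∈C))) ∷ sep i j i<s j<s)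
             , λ i _ i∈C → C=∅ (i , i∈C)) }) ⟩
    𝟙 (isStirlingPartition? (pred r) m S)
      ≡⟨ rearrange _ (𝟙 (avoids? (pred r) C)) ⟩
    1 * 𝟙 (isStirlingPartition? (pred r) m S) + 𝟙 (avoids? (pred r) C) * 0
      ≡⟨ cong (λ t → 1 * 𝟙 (isStirlingPartition? (pred r) m S) + 𝟙 (avoids? (pred r) C) * t)
           (𝟙-no (isStirlingPartition? (pred r) (suc m) (C ∷ S)) (λ { ((C≠∅ ∷ _ , _) , _) → C=∅ C≠∅ })) ⟨
    1 * 𝟙 (isStirlingPartition? (pred r) m S) +
    𝟙 (avoids? (pred r) C) * 𝟙 (isStirlingPartition? (pred r) (suc m) (C ∷ S)) ∎

-- Recurrence for the r-Stirling numbers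

stirling≡∑ : ∀ r n m → stirling r n m ≡ ∑ (sublists (subsets n)) (𝟙 ∘ isStirlingPartition? r m)
stirling≡∑ r n m = length-filter≡∑𝟙 (isStirlingPartition? r m) (families n)

-- `subsets (suc n)` lists the sets without zero before those with zero, so a family is a sublist
-- `S` of the former followed by a sublist `T` of the latter. In a partition `T` is a single block,
-- which is then moved to the front.
stirling-suc≡∑ : ∀ r n m → stirling r (suc n) m ≡
  ∑ (sublists (subsets n)) (λ S → ∑ (subsets n) (λ C → 𝟙 (isStirlingPartition? r m ((true ∷ C) ∷ map (false ∷_) S))))
stirling-suc≡∑ r n m = begin
  stirling r (suc n) m
    ≡⟨ stirling≡∑ r (suc n) m ⟩
  ∑ (sublists (map (false ∷_) (subsets n) ++ map (true ∷_) (subsets n))) st𝟙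
    ≡⟨ ∑-sublists-++ (map (false ∷_) (subsets n)) (map (true ∷_) (subsets n)) st𝟙 ⟩
  ∑ (sublists (map (false ∷_) (subsets n))) (λ S → ∑ (sublists (map (true ∷_) (subsets n))) (λ T → st𝟙 (S ++ T)))
    ≡⟨ ∑-sublists-map (false ∷_) (subsets n) _ ⟩
  ∑ (sublists (subsets n)) (λ S → ∑ (sublists (map (true ∷_) (subsets n))) (λ T → st𝟙 (map (false ∷_) S ++ T)))
    ≡⟨ ∑-cong (sublists (subsets n)) (λ S → trans
         (∑-sublists-map (true ∷_) (subsets n) _)
         (∑-cong (sublists (subsets n)) (λ T → st𝟙-↭ (++-comm (map (false ∷_) S) (map (true ∷_) T))))) ⟩
  ∑ (sublists (subsets n)) (λ S → ∑ (sublists (subsets n)) (λ T → st𝟙 (map (true ∷_) T ++ map (false ∷_) S)))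
    ≡⟨ ∑-cong (sublists (subsets n)) (λ S → ∑-sublists-singletons (subsets n) (no-block S) (two-blocks S)) ⟩
  ∑ (sublists (subsets n)) (λ S → ∑ (subsets n) (λ C → st𝟙 ((true ∷ C) ∷ map (false ∷_) S))) ∎
  where
  open ≡-Reasoning
  st𝟙 : List (Subset (suc n)) → ℕ
  st𝟙 S = 𝟙 (isStirlingPartition? r m S)

  st𝟙-↭ : ∀ {S T} → S ↭ T → st𝟙 S ≡ st𝟙 T
  st𝟙-↭ {S} {T} σ = 𝟙-cong (isStirlingPartition? r m S) (isStirlingPartition? r m T)
    (isStirlingPartition-resp-↭ σ) (isStirlingPartition-resp-↭ (↭-sym σ))

  no-block : ∀ S → st𝟙 (map (false ∷_) S) ≡ 0
  no-block S = 𝟙-no (isStirlingPartition? r m (map (false ∷_) S))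
    (λ { ((_ , _ , cover) , _) → uncovered (Any.map⁻ (cover fzero)) })
    where
    uncovered : ∀ {S : List (Subset n)} → ¬ Any (λ C → fzero ∈ false ∷ C) S
    uncovered (there 0∈S) = uncovered 0∈S

  two-blocks : ∀ S C D T → st𝟙 (map (true ∷_) (C ∷ D ∷ T) ++ map (false ∷_) S) ≡ 0
  two-blocks S C D T = 𝟙-no (isStirlingPartition? r m (map (true ∷_) (C ∷ D ∷ T) ++ map (false ∷_) S))
    (λ { ((_ , (C∥D ∷ _) ∷ _ , _) , _) → disjoint⁻ C∥D here here })

stirling-zero-zero : ∀ n → stirling 0 (suc n) 0 ≡ 0
stirling-zero-zero n = trans (stirling-suc≡∑ 0 n 0)
  (∑-zero (sublists (subsets n)) (λ S → ∑-zero (subsets n) (λ C →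
    𝟙-no (isStirlingPartition? 0 0 ((true ∷ C) ∷ map (false ∷_) S)) (λ { (_ , () , _) }))))

-- Remove the element zero: either it was a singleton block, or it is put back into one of
-- the k blocks that contain none of the pred r remaining distinguished elements.
stirling-suc : ∀ r n m k → pred r ≤ n → k + pred r ≡ suc m →
  stirling r (suc n) (suc m) ≡ stirling (pred r) n m + k * stirling (pred r) n (suc m)
stirling-suc r n m k s≤n k+s≡1+m = begin
  stirling r (suc n) (suc m)
    ≡⟨ stirling-suc≡∑ r n (suc m) ⟩
  ∑ subs (λ S → ∑ (subsets n) (λ C → 𝟙 (isStirlingPartition? r (suc m) ((true ∷ C) ∷ map (false ∷_) S))))
    ≡⟨ ∑-cong subs (λ S → trans (∑-cong (subsets n) (λ C → 𝟙-isStirlingPartition-∷ r m C S)) (∑-+ (subsets n) _ _)) ⟩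
  ∑ subs (λ S → ∑ (subsets n) (λ C → 𝟙 (¬? (nonempty? C)) * 𝟙 (isStirlingPartition? s m S)) +
                ∑ (subsets n) (λ C → rest C S))
    ≡⟨ ∑-+ subs _ _ ⟩
  ∑ subs (λ S → ∑ (subsets n) (λ C → 𝟙 (¬? (nonempty? C)) * 𝟙 (isStirlingPartition? s m S))) +
  ∑ subs (λ S → ∑ (subsets n) (λ C → rest C S))
    ≡⟨ cong₂ _+_ singleton-block other-block ⟩
  stirling s n m + k * stirling s n (suc m) ∎
  where
  open ≡-Reasoning
  s = pred r
  subs = sublists (subsets n)

  rest : Subset n → List (Subset n) → ℕ
  rest C S = 𝟙 (avoids? s C) * 𝟙 (isStirlingPartition? s (suc m) (C ∷ S))

  singleton-block : ∑ subs (λ S → ∑ (subsets n) (λ C → 𝟙 (¬? (nonempty? C)) * 𝟙 (isStirlingPartition? s m S))) ≡ stirling s n m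
  singleton-block = trans
    (∑-cong subs (λ S → trans (∑-*ʳ (subsets n) _ _) (trans (cong (_* 𝟙 (isStirlingPartition? s m S)) (∑-subsets-empty n)) (*-identityˡ _))))
    (sym (stirling≡∑ s n m))

  -- A repeated block would be disjoint from itself, although it is nonempty.
  rest-∈ : ∀ C S → C ∈ᴸ S → rest C S ≡ 0
  rest-∈ C S C∈S = trans
    (cong (𝟙 (avoids? s C) *_) (𝟙-no (isStirlingPartition? s (suc m) (C ∷ S))
      (λ { (((i , i∈C) ∷ _ , C∥S ∷ _ , _) , _) → disjoint⁻ (All.lookup C∥S C∈S) i∈C i∈C })))
    (*-zeroʳ (𝟙 (avoids? s C)))

  -- Of the `suc m` blocks, `s` hold a distinguished element; `k + s ≡ suc m` leaves `k`.
  avoid-count : ∀ S → ∑ S (λ C → 𝟙 (avoids? s C)) * 𝟙 (isStirlingPartition? s (suc m) S) ≡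
                𝟙 (isStirlingPartition? s (suc m) S) * k
  avoid-count S = *-𝟙-subst (isStirlingPartition? s (suc m) S) λ { ((_ , pairs , cover) , len , sep) →
    +-cancelʳ-≡ s _ k (trans (∑-avoids s S s≤n pairs cover sep) (trans len (sym k+s≡1+m))) }

  other-block : ∑ subs (λ S → ∑ (subsets n) (λ C → rest C S)) ≡ k * stirling s n (suc m)
  other-block = begin
    ∑ subs (λ S → ∑ (subsets n) (λ C → rest C S))
      ≡⟨ ∑-swap subs (subsets n) (λ S C → rest C S) ⟩
    ∑ (subsets n) (λ C → ∑ subs (rest C))
      -- A block `C` with the remaining blocks is a partition with one marked block, so each
      -- partition is counted once per block avoiding the distinguished elements.
      ≡⟨ ∑-sublists-pick (subsets n) rest rest-∈ ⟩
    ∑ subs (∑-pick rest)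
      ≡⟨ ∑-cong subs (λ S → trans
           (∑-pick-factor S rest (𝟙 (isStirlingPartition? s (suc m) S)) (λ C → 𝟙 (avoids? s C))
             (λ C S′ σ → cong (𝟙 (avoids? s C) *_) (𝟙-cong (isStirlingPartition? s (suc m) (C ∷ S′)) (isStirlingPartition? s (suc m) S)
               (isStirlingPartition-resp-↭ σ) (isStirlingPartition-resp-↭ (↭-sym σ)))))
           (avoid-count S)) ⟩
    ∑ subs (λ S → 𝟙 (isStirlingPartition? s (suc m) S) * k)
      ≡⟨ ∑-*ʳ subs _ k ⟩
    ∑ subs (𝟙 ∘ isStirlingPartition? s (suc m)) * k
      ≡⟨ cong (_* k) (stirling≡∑ s n (suc m)) ⟨
    stirling s n (suc m) * k
      ≡⟨ *-comm _ k ⟩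
    k * stirling s n (suc m) ∎

-- The triangular recurrence and the r-Fubini numbers

-- The numbers that occur in `fubini`: `n` counts the undistinguished elements and `k` the blocks
-- without a distinguished one.
shiftedStirling : ℕ → ℕ → ℕ → ℕ
shiftedStirling r n k = stirling r (n + r) (k + r)

-- The removed element is distinguished here, so `r` drops while `n` stays; it can return to any of
-- the `suc k` blocks free of distinguished elements.
shiftedStirling-suc-r : ∀ r n k →
  shiftedStirling (suc r) n k ≡ shiftedStirling r n k + suc k * shiftedStirling r n (suc k)
shiftedStirling-suc-r r n k rewrite +-suc n r | +-suc k r =
  stirling-suc (suc r) (n + r) (k + r) (suc k) (m≤n+m r n) refl

-- For `r > 0` removing zero changes `r`, so the recurrences at fixed `r` are proved together by
-- induction on `r` through `shiftedStirling-suc-r`. At `r = 0` the removed element is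
-- undistinguished and they follow directly.
shiftedStirling-suc-zero : ∀ r n → shiftedStirling r (suc n) 0 ≡ r * shiftedStirling r n 0
shiftedStirling-suc-suc : ∀ r n k →
  shiftedStirling r (suc n) (suc k) ≡ shiftedStirling r n k + (suc k + r) * shiftedStirling r n (suc k)

shiftedStirling-suc-zero zero    n = stirling-zero-zero (n + 0)
shiftedStirling-suc-zero (suc r) n = begin
  T (suc r) (suc n) 0                                  ≡⟨ shiftedStirling-suc-r r (suc n) 0 ⟩
  T r (suc n) 0 + 1 * T r (suc n) 1                    ≡⟨ cong₂ (λ x y → x + 1 * y) (shiftedStirling-suc-zero r n) (shiftedStirling-suc-suc r n 0) ⟩
  r * T r n 0 + 1 * (T r n 0 + (1 + r) * T r n 1)      ≡⟨ rearrange r (T r n 0) (T r n 1) ⟩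
  (1 + r) * (T r n 0 + 1 * T r n 1)                    ≡⟨ cong (suc r *_) (shiftedStirling-suc-r r n 0) ⟨
  suc r * T (suc r) n 0                                ∎
  where
  open ≡-Reasoning
  T = shiftedStirling
  rearrange : ∀ r x y → r * x + 1 * (x + (1 + r) * y) ≡ (1 + r) * (x + 1 * y)
  rearrange = solve-∀

shiftedStirling-suc-suc zero    n k = trans
  (stirling-suc 0 (n + 0) (k + 0) (suc k) z≤n refl)
  (cong (λ t → shiftedStirling 0 n k + t * shiftedStirling 0 n (suc k)) (sym (+-identityʳ (suc k))))
shiftedStirling-suc-suc (suc r) n k = begin
  T (suc r) (suc n) (suc k)
    ≡⟨ shiftedStirling-suc-r r (suc n) (suc k) ⟩
  T r (suc n) (suc k) + (2 + k) * T r (suc n) (2 + k)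
    ≡⟨ cong₂ (λ x y → x + (2 + k) * y) (shiftedStirling-suc-suc r n k) (shiftedStirling-suc-suc r n (suc k)) ⟩
  (T r n k + (1 + k + r) * T r n (suc k)) + (2 + k) * (T r n (suc k) + (2 + k + r) * T r n (2 + k))
    ≡⟨ rearrange r k (T r n k) (T r n (suc k)) (T r n (2 + k)) ⟩
  (T r n k + (1 + k) * T r n (suc k)) + (1 + k + (1 + r)) * (T r n (suc k) + (2 + k) * T r n (2 + k))
    ≡⟨ cong₂ (λ x y → x + (suc k + suc r) * y) (shiftedStirling-suc-r r n k) (shiftedStirling-suc-r r n (suc k)) ⟨
  T (suc r) n k + (suc k + suc r) * T (suc r) n (suc k) ∎
  where
  open ≡-Reasoning
  T = shiftedStirling
  rearrange : ∀ r k x y z →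
    (x + (1 + k + r) * y) + (2 + k) * (y + (2 + k + r) * z) ≡
    (x + (1 + k) * y) + (1 + k + (1 + r)) * (y + (2 + k) * z)
  rearrange = solve-∀

shiftedStirling-0-suc : ∀ r k → shiftedStirling r 0 (suc k) ≡ 0
shiftedStirling-0-suc zero    k = refl
shiftedStirling-0-suc (suc r) k = trans (shiftedStirling-suc-r r 0 (suc k))
  (trans (cong₂ (λ x y → x + (2 + k) * y) (shiftedStirling-0-suc r k) (shiftedStirling-0-suc r (suc k))) (*-zeroʳ (2 + k)))

shiftedStirling-0-0 : ∀ r → shiftedStirling r 0 0 ≡ 1
shiftedStirling-0-0 zero    = refl
shiftedStirling-0-0 (suc r) = trans (shiftedStirling-suc-r r 0 0)
  (cong₂ (λ x y → x + 1 * y) (shiftedStirling-0-0 r) (shiftedStirling-0-suc r 0))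

shiftedStirling-> : ∀ r n k → n < k → shiftedStirling r n k ≡ 0
shiftedStirling-> r zero    (suc k) _         = shiftedStirling-0-suc r k
shiftedStirling-> r (suc n) (suc k) (s≤s n<k) = trans (shiftedStirling-suc-suc r n k)
  (trans (cong₂ (λ x y → x + (suc k + r) * y) (shiftedStirling-> r n k n<k) (shiftedStirling-> r n (suc k) (m<n⇒m<1+n n<k)))
    (*-zeroʳ (suc k + r)))

∑-upTo-suc : ∀ n (f : ℕ → ℕ) → ∑ (upTo (suc n)) f ≡ f 0 + ∑ (upTo n) (f ∘ suc)
∑-upTo-suc n f = cong (λ xs → f 0 + sum xs) (trans (map-applyUpTo suc f n) (sym (map-upTo (f ∘ suc) n)))

∑-upTo-∷ʳ : ∀ n (f : ℕ → ℕ) → ∑ (upTo (suc n)) f ≡ ∑ (upTo n) f + f n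
∑-upTo-∷ʳ n f = trans (cong (λ xs → ∑ xs f) (sym (upTo-∷ʳ n)))
  (trans (∑-++ (upTo n) [ n ] f) (cong (∑ (upTo n) f +_) (+-identityʳ (f n))))

fubini-zero : ∀ r → fubini 0 r ≡ r !
fubini-zero r = trans (cong (λ t → r ! * t + 0) (shiftedStirling-0-0 r)) (trans (+-identityʳ _) (*-identityʳ (r !)))

-- Split the factor `suc k + r` of the triangular recurrence. The part `r` yields `r * fubini n r`;
-- the part `suc k` joins the other summand to form an entry for `suc r`.
fubini-suc : ∀ n r → fubini (suc n) r ≡ r * fubini n r + fubini n (suc r)
fubini-suc n r = begin
  ∑ (upTo (2 + n)) f′
    ≡⟨ ∑-upTo-suc (suc n) f′ ⟩
  f′ 0 + ∑ (upTo (suc n)) (f′ ∘ suc)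
    ≡⟨ cong₂ _+_ f′-zero (trans (∑-cong (upTo (suc n)) f′-suc) (∑-+ (upTo (suc n)) (λ k → f (suc k) * r) g)) ⟩
  f 0 * r + (∑ (upTo (suc n)) (λ k → f (suc k) * r) + ∑ (upTo (suc n)) g)
    ≡⟨ cong (λ t → f 0 * r + (t + ∑ (upTo (suc n)) g)) (∑-*ʳ (upTo (suc n)) (f ∘ suc) r) ⟩
  f 0 * r + (∑ (upTo (suc n)) (f ∘ suc) * r + ∑ (upTo (suc n)) g)
    ≡⟨ rearrange (f 0) (∑ (upTo (suc n)) (f ∘ suc)) (∑ (upTo (suc n)) g) r ⟩
  r * (f 0 + ∑ (upTo (suc n)) (f ∘ suc)) + ∑ (upTo (suc n)) g
    ≡⟨ cong (λ t → r * t + ∑ (upTo (suc n)) g) (∑-upTo-suc (suc n) f) ⟨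
  r * ∑ (upTo (2 + n)) f + ∑ (upTo (suc n)) g
    ≡⟨ cong (λ t → r * t + ∑ (upTo (suc n)) g) (trans (∑-upTo-∷ʳ (suc n) f) (trans (cong (∑ (upTo (suc n)) f +_) f-last) (+-identityʳ _))) ⟩
  r * ∑ (upTo (suc n)) f + ∑ (upTo (suc n)) g ∎
  where
  open ≡-Reasoning
  T = shiftedStirling
  f f′ g : ℕ → ℕ
  f  k = (k + r) ! * T r n k
  f′ k = (k + r) ! * T r (suc n) k
  g  k = (k + suc r) ! * T (suc r) n k

  -- The sum for `suc n` runs one index further than the sum for `n`.
  f-last : f (suc n) ≡ 0
  f-last = trans (cong ((suc n + r) ! *_) (shiftedStirling-> r n (suc n) (n<1+n n))) (*-zeroʳ ((suc n + r) !))

  f′-zero : f′ 0 ≡ f 0 * r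
  f′-zero = trans (cong (r ! *_) (trans (shiftedStirling-suc-zero r n) (*-comm r _))) (sym (*-assoc (r !) _ r))

  expand : ∀ c r k x y → c * (x + (1 + k + r) * y) ≡ c * y * r + c * (x + (1 + k) * y)
  expand = solve-∀

  f′-suc : ∀ k → f′ (suc k) ≡ f (suc k) * r + g k
  f′-suc k = begin
    (suc k + r) ! * T r (suc n) (suc k)
      ≡⟨ cong ((suc k + r) ! *_) (shiftedStirling-suc-suc r n k) ⟩
    (suc k + r) ! * (T r n k + (suc k + r) * T r n (suc k))
      ≡⟨ expand ((suc k + r) !) r k (T r n k) (T r n (suc k)) ⟩
    f (suc k) * r + (suc k + r) ! * (T r n k + suc k * T r n (suc k))
      ≡⟨ cong (f (suc k) * r +_) (cong₂ (λ i t → i ! * t) (+-suc k r) (shiftedStirling-suc-r r n k)) ⟨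
    f (suc k) * r + g k ∎

  rearrange : ∀ a b c r → a * r + (b * r + c) ≡ r * (a + b) + c
  rearrange = solve-∀

-- Evaluation at negative integers

open import Data.Integer.Base as ℤ using (ℤ; +_; -[1+_]; 0ℤ; 1ℤ; -1ℤ)
open import Data.Integer.Divisibility.Signed using (_∣_; divides; ∣-refl; ∣-trans; ∣m∣n⇒∣m+n; ∣m∣n⇒∣m-n; ∣n⇒∣m*n; ∣m⇒∣m*n; *-monoʳ-∣; *-monoˡ-∣; ∣⇒∣ᵤ)
import Data.Integer.Properties as ℤ
import Data.Integer.Tactic.RingSolver as ℤ

2ℤ : ℤ
2ℤ = + 2

fall : ℤ → ℕ → ℤ
fall x zero    = 1ℤ
fall x (suc r) = fall x r ℤ.* (x ℤ.- + r)

fall-0-suc : ∀ r → fall 0ℤ (suc r) ≡ 0ℤ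
fall-0-suc zero    = refl
fall-0-suc (suc r) = cong (ℤ._* (0ℤ ℤ.- + suc r)) (fall-0-suc r)

-- Splits off the largest factor rather than the smallest, which makes neighbouring arguments
-- comparable in the telescoping.
fall-1+ : ∀ x r → fall (1ℤ ℤ.+ x) (suc r) ≡ (1ℤ ℤ.+ x) ℤ.* fall x r
fall-1+ x zero    = base x
  where
  base : ∀ x → 1ℤ ℤ.* ((1ℤ ℤ.+ x) ℤ.- 0ℤ) ≡ (1ℤ ℤ.+ x) ℤ.* 1ℤ
  base = ℤ.solve-∀
fall-1+ x (suc r) = trans (cong (ℤ._* (1ℤ ℤ.+ x ℤ.- + suc r)) (fall-1+ x r)) (step x (fall x r) (+ r))
  where
  step : ∀ x f r → (1ℤ ℤ.+ x) ℤ.* f ℤ.* (1ℤ ℤ.+ x ℤ.- (1ℤ ℤ.+ r)) ≡ (1ℤ ℤ.+ x) ℤ.* (f ℤ.* (x ℤ.- r))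
  step = ℤ.solve-∀

-- weighted M h is the sum of 2 ^ (j - 1) * h (- j) over 1 ≤ j ≤ M.
weighted : ℕ → (ℤ → ℤ) → ℤ
weighted zero    h = 0ℤ
weighted (suc M) h = weighted M h ℤ.+ 2ℤ ℤ.^ M ℤ.* h -[1+ M ]

weighted-cong : ∀ M {f g : ℤ → ℤ} → (∀ x → f x ≡ g x) → weighted M f ≡ weighted M g
weighted-cong zero    f≗g = refl
weighted-cong (suc M) f≗g = cong₂ (λ w t → w ℤ.+ 2ℤ ℤ.^ M ℤ.* t) (weighted-cong M f≗g) (f≗g -[1+ M ])

weighted-linear : ∀ M c (f g : ℤ → ℤ) →
  weighted M (λ x → c ℤ.* f x ℤ.+ g x) ≡ c ℤ.* weighted M f ℤ.+ weighted M g
weighted-linear zero    c f g = base c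
  where
  base : ∀ c → 0ℤ ≡ c ℤ.* 0ℤ ℤ.+ 0ℤ
  base = ℤ.solve-∀
weighted-linear (suc M) c f g = trans
  (cong (ℤ._+ 2ℤ ℤ.^ M ℤ.* (c ℤ.* f -[1+ M ] ℤ.+ g -[1+ M ])) (weighted-linear M c f g))
  (step c (2ℤ ℤ.^ M) (weighted M f) (weighted M g) (f -[1+ M ]) (g -[1+ M ]))
  where
  step : ∀ c t F G x y → (c ℤ.* F ℤ.+ G) ℤ.+ t ℤ.* (c ℤ.* x ℤ.+ y) ≡ c ℤ.* (F ℤ.+ t ℤ.* x) ℤ.+ (G ℤ.+ t ℤ.* y)
  step = ℤ.solve-∀

weighted-∣ : ∀ {d} M {h : ℤ → ℤ} → (∀ j → d ∣ 2ℤ ℤ.^ j ℤ.* h -[1+ j ]) → d ∣ weighted M h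
weighted-∣ zero    d∣h = divides 0ℤ refl
weighted-∣ (suc M) d∣h = ∣m∣n⇒∣m+n (weighted-∣ M d∣h) (d∣h M)

-- The geometric series 1 + 2 + 4 + ..., with the extra 1 closing it up to a power of two.
weighted-1 : ∀ M → 1ℤ ℤ.+ weighted M (λ x → fall x 0) ≡ 2ℤ ℤ.^ M
weighted-1 zero    = refl
weighted-1 (suc M) = begin
  1ℤ ℤ.+ (weighted M (λ x → fall x 0) ℤ.+ 2ℤ ℤ.^ M ℤ.* 1ℤ)
    ≡⟨ assoc (weighted M (λ x → fall x 0)) (2ℤ ℤ.^ M) ⟩
  (1ℤ ℤ.+ weighted M (λ x → fall x 0)) ℤ.+ 2ℤ ℤ.^ M
    ≡⟨ cong (ℤ._+ 2ℤ ℤ.^ M) (weighted-1 M) ⟩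
  2ℤ ℤ.^ M ℤ.+ 2ℤ ℤ.^ M
    ≡⟨ double (2ℤ ℤ.^ M) ⟩
  2ℤ ℤ.^ suc M ∎
  where
  open ≡-Reasoning
  assoc : ∀ w t → 1ℤ ℤ.+ (w ℤ.+ t ℤ.* 1ℤ) ≡ (1ℤ ℤ.+ w) ℤ.+ t
  assoc = ℤ.solve-∀
  double : ∀ t → t ℤ.+ t ≡ + 2 ℤ.* t
  double = ℤ.solve-∀

-- Telescoping, as fall (1 + x) (1 + r) - fall x (1 + r) = (1 + r) * fall x r.
weighted-fall-suc : ∀ M r → weighted M (λ x → fall x (suc r)) ≡
  + suc r ℤ.* weighted M (λ x → fall x r) ℤ.+ 2ℤ ℤ.^ M ℤ.* fall (ℤ.- + M) (suc r)
-- The boundary term for `M = 0` vanishes because 0 is a root of the falling factorial.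
weighted-fall-suc zero    r = sym (trans (cong (λ t → + suc r ℤ.* 0ℤ ℤ.+ 1ℤ ℤ.* t) (fall-0-suc r)) (base (+ suc r)))
  where
  base : ∀ c → c ℤ.* 0ℤ ℤ.+ 1ℤ ℤ.* 0ℤ ≡ 0ℤ
  base = ℤ.solve-∀
weighted-fall-suc (suc M) r = begin
  weighted M (λ x → fall x (suc r)) ℤ.+ t ℤ.* fall x (suc r)
    ≡⟨ cong (ℤ._+ t ℤ.* fall x (suc r)) (weighted-fall-suc M r) ⟩
  (+ suc r ℤ.* w ℤ.+ t ℤ.* fall (ℤ.- + M) (suc r)) ℤ.+ t ℤ.* fall x (suc r)
    -- The old boundary argument `- M` lies one above the new sample point `x`. The two terms with
    -- weight `t` then combine into a multiple of `suc r` and a boundary term with the doubled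
    -- weight.
    ≡⟨ cong (λ y → (+ suc r ℤ.* w ℤ.+ t ℤ.* y) ℤ.+ t ℤ.* fall x (suc r))
         (trans (cong (λ y → fall y (suc r)) (-M≡1+x M)) (fall-1+ x r)) ⟩
  (+ suc r ℤ.* w ℤ.+ t ℤ.* ((1ℤ ℤ.+ x) ℤ.* fall x r)) ℤ.+ t ℤ.* (fall x r ℤ.* (x ℤ.- + r))
    ≡⟨ step w t x (fall x r) (+ r) ⟩
  + suc r ℤ.* (w ℤ.+ t ℤ.* fall x r) ℤ.+ 2ℤ ℤ.* t ℤ.* (fall x r ℤ.* (x ℤ.- + r)) ∎
  where
  open ≡-Reasoning
  t = 2ℤ ℤ.^ M
  x = -[1+ M ]
  w = weighted M (λ x → fall x r)
  -M≡1+x : ∀ M → ℤ.- + M ≡ 1ℤ ℤ.+ -[1+ M ]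
  -M≡1+x zero    = refl
  -M≡1+x (suc M) = refl
  step : ∀ w t x f r →
    ((1ℤ ℤ.+ r) ℤ.* w ℤ.+ t ℤ.* ((1ℤ ℤ.+ x) ℤ.* f)) ℤ.+ t ℤ.* (f ℤ.* (x ℤ.- r)) ≡
    (1ℤ ℤ.+ r) ℤ.* (w ℤ.+ t ℤ.* f) ℤ.+ + 2 ℤ.* t ℤ.* (f ℤ.* (x ℤ.- r))
  step = ℤ.solve-∀

-- Passing from `r` to `suc r` multiplies both summands by `suc r`, up to a boundary term divisible
-- by `2ℤ ^ M`.
factorial-weighted : ∀ M r → 2ℤ ℤ.^ M ∣ + (r !) ℤ.+ weighted M (λ x → fall x r)
factorial-weighted M zero    = subst (2ℤ ℤ.^ M ∣_) (sym (weighted-1 M)) ∣-refl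
factorial-weighted M (suc r) = subst (2ℤ ℤ.^ M ∣_) (sym eq)
  (∣m∣n⇒∣m+n (∣n⇒∣m*n (+ suc r) (factorial-weighted M r)) (∣m⇒∣m*n (fall (ℤ.- + M) (suc r)) ∣-refl))
  where
  w = weighted M (λ x → fall x r)
  u = 2ℤ ℤ.^ M ℤ.* fall (ℤ.- + M) (suc r)
  step : ∀ c f w u → c ℤ.* f ℤ.+ (c ℤ.* w ℤ.+ u) ≡ c ℤ.* (f ℤ.+ w) ℤ.+ u
  step = ℤ.solve-∀
  eq : + (suc r !) ℤ.+ weighted M (λ x → fall x (suc r)) ≡ + suc r ℤ.* (+ (r !) ℤ.+ w) ℤ.+ u
  eq = trans (cong₂ ℤ._+_ (ℤ.pos-* (suc r) (r !)) (weighted-fall-suc M r)) (step (+ suc r) (+ (r !)) w u)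

-- Since x * fall x r = r * fall x r + fall x (r + 1), the weighted sums obey the recurrence
-- `fubini-suc`; the factorials start the induction on `n`.
fubini-weighted : ∀ M n r → 2ℤ ℤ.^ M ∣ + fubini n r ℤ.+ weighted M (λ x → x ℤ.^ n ℤ.* fall x r)
fubini-weighted M zero    r = subst (2ℤ ℤ.^ M ∣_)
  (sym (cong₂ (λ f w → + f ℤ.+ w) (fubini-zero r) (weighted-cong M (λ x → ℤ.*-identityˡ (fall x r)))))
  (factorial-weighted M r)
fubini-weighted M (suc n) r = subst (2ℤ ℤ.^ M ∣_) (sym eq)
  (∣m∣n⇒∣m+n (∣n⇒∣m*n (+ r) (fubini-weighted M n r)) (fubini-weighted M n (suc r)))
  where
  W : ℕ → ℕ → ℤ
  W n r = weighted M (λ x → x ℤ.^ n ℤ.* fall x r)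
  expand : ∀ x p f r → x ℤ.* p ℤ.* f ≡ r ℤ.* (p ℤ.* f) ℤ.+ p ℤ.* (f ℤ.* (x ℤ.- r))
  expand = ℤ.solve-∀
  step : ∀ r a b v w → (r ℤ.* a ℤ.+ b) ℤ.+ (r ℤ.* v ℤ.+ w) ≡ r ℤ.* (a ℤ.+ v) ℤ.+ (b ℤ.+ w)
  step = ℤ.solve-∀
  eq : + fubini (suc n) r ℤ.+ W (suc n) r ≡ + r ℤ.* (+ fubini n r ℤ.+ W n r) ℤ.+ (+ fubini n (suc r) ℤ.+ W n (suc r))
  eq = trans
    (cong₂ ℤ._+_
      (trans (cong +_ (fubini-suc n r)) (cong (ℤ._+ + fubini n (suc r)) (ℤ.pos-* r (fubini n r))))
      (trans (weighted-cong M (λ x → expand x (x ℤ.^ n) (fall x r) (+ r)))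
             (weighted-linear M (+ r) (λ x → x ℤ.^ n ℤ.* fall x r) (λ x → x ℤ.^ n ℤ.* fall x (suc r)))))
    (step (+ r) (+ fubini n r) (+ fubini n (suc r)) (W n r) (W n (suc r)))

-- Powers of odd integers modulo powers of two

*-mono-∣ : ∀ {a b c d} → a ∣ b → c ∣ d → a ℤ.* c ∣ b ℤ.* d
*-mono-∣ {a} {b} {c} {d} a∣b c∣d = ∣-trans (*-monoˡ-∣ c a∣b) (*-monoʳ-∣ b c∣d)

parity : ∀ x → (∃[ y ] x ≡ 2ℤ ℤ.* y) ⊎ (∃[ y ] x ≡ 1ℤ ℤ.+ 2ℤ ℤ.* y)
parity (+ zero) = inj₁ (0ℤ , refl)
parity (+ suc n) with parity (+ n)
... | inj₁ (y , eq) = inj₂ (y , cong ℤ.suc eq)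
... | inj₂ (y , eq) = inj₁ (1ℤ ℤ.+ y , trans (cong ℤ.suc eq) (carry y))
  where
  carry : ∀ y → 1ℤ ℤ.+ (1ℤ ℤ.+ + 2 ℤ.* y) ≡ + 2 ℤ.* (1ℤ ℤ.+ y)
  carry = ℤ.solve-∀
parity -[1+ zero ] = inj₂ (-1ℤ , refl)
parity -[1+ suc n ] with parity -[1+ n ]
... | inj₁ (y , eq) = inj₂ (-1ℤ ℤ.+ y , trans (cong ℤ.pred eq) (borrow y))
  where
  borrow : ∀ y → -1ℤ ℤ.+ + 2 ℤ.* y ≡ 1ℤ ℤ.+ + 2 ℤ.* (-1ℤ ℤ.+ y)
  borrow = ℤ.solve-∀
... | inj₂ (y , eq) = inj₁ (y , trans (cong ℤ.pred eq) (cancel y))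
  where
  cancel : ∀ y → -1ℤ ℤ.+ (1ℤ ℤ.+ + 2 ℤ.* y) ≡ + 2 ℤ.* y
  cancel = ℤ.solve-∀

2∣y[1+y] : ∀ y → 2ℤ ∣ y ℤ.* (1ℤ ℤ.+ y)
2∣y[1+y] y with parity y
... | inj₁ (z , refl) = ∣m⇒∣m*n (1ℤ ℤ.+ 2ℤ ℤ.* z) (∣m⇒∣m*n z ∣-refl)
... | inj₂ (z , refl) = ∣n⇒∣m*n (1ℤ ℤ.+ 2ℤ ℤ.* z) (divides (1ℤ ℤ.+ z) (eq z))
  where
  eq : ∀ z → 1ℤ ℤ.+ (1ℤ ℤ.+ + 2 ℤ.* z) ≡ (1ℤ ℤ.+ z) ℤ.* + 2
  eq = ℤ.solve-∀

-- In y^2 - 1 = (y + 1)(y - 1) the first factor is even, because `y` is odd.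
2^-∣-square : ∀ a y → 2ℤ ℤ.^ suc a ∣ y ℤ.- 1ℤ → 2ℤ ℤ.^ suc (suc a) ∣ y ℤ.^ 2 ℤ.- 1ℤ
2^-∣-square a y d = subst (2ℤ ℤ.^ suc (suc a) ∣_) (eq y)
  (*-mono-∣ (∣m∣n⇒∣m+n (∣-trans (∣m⇒∣m*n (2ℤ ℤ.^ a) ∣-refl) d) ∣-refl) d)
  where
  eq : ∀ y → ((y ℤ.- 1ℤ) ℤ.+ + 2) ℤ.* (y ℤ.- 1ℤ) ≡ y ℤ.* (y ℤ.* 1ℤ) ℤ.- 1ℤ
  eq = ℤ.solve-∀

2^-∣-power : ∀ e a y → 2ℤ ℤ.^ suc a ∣ y ℤ.- 1ℤ → 2ℤ ℤ.^ (e + suc a) ∣ y ℤ.^ (2 ^ e) ℤ.- 1ℤ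
2^-∣-power zero    a y d = subst (λ z → 2ℤ ℤ.^ suc a ∣ z ℤ.- 1ℤ) (sym (ℤ.^-identityʳ y)) d
2^-∣-power (suc e) a y d = subst (λ k → 2ℤ ℤ.^ k ∣ y ℤ.^ (2 ^ suc e) ℤ.- 1ℤ) (+-suc e (suc a))
  (subst (λ z → 2ℤ ℤ.^ (e + suc (suc a)) ∣ z ℤ.- 1ℤ) (ℤ.^-*-assoc y 2 (2 ^ e))
    (2^-∣-power e (suc a) (y ℤ.^ 2) (2^-∣-square a y d)))

-- An odd square is 1 modulo 8, as (1 + 2y)^2 - 1 = 4y(1 + y); each of the `e` further squarings
-- gains a factor 2.
odd-power : ∀ e y → 2ℤ ℤ.^ (e + 3) ∣ (1ℤ ℤ.+ 2ℤ ℤ.* y) ℤ.^ (2 ^ suc e) ℤ.- 1ℤ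
odd-power e y = subst (λ z → 2ℤ ℤ.^ (e + 3) ∣ z ℤ.- 1ℤ) (ℤ.^-*-assoc (1ℤ ℤ.+ 2ℤ ℤ.* y) 2 (2 ^ e))
  (2^-∣-power e 2 ((1ℤ ℤ.+ 2ℤ ℤ.* y) ℤ.^ 2) (subst (2ℤ ℤ.^ 3 ∣_) (eq y) (*-monoʳ-∣ (+ 4) (2∣y[1+y] y))))
  where
  eq : ∀ y → + 4 ℤ.* (y ℤ.* (1ℤ ℤ.+ y)) ≡ (1ℤ ℤ.+ + 2 ℤ.* y) ℤ.* ((1ℤ ℤ.+ + 2 ℤ.* y) ℤ.* 1ℤ) ℤ.- 1ℤ
  eq = ℤ.solve-∀

2^-mono-∣ : ∀ {a b} → a ≤ b → 2ℤ ℤ.^ a ∣ 2ℤ ℤ.^ b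
2^-mono-∣ {b = b} z≤n = divides (2ℤ ℤ.^ b) (sym (ℤ.*-identityʳ _))
2^-mono-∣ (s≤s a≤b) = *-monoʳ-∣ 2ℤ (2^-mono-∣ a≤b)

2^∣even^ : ∀ n y → 2ℤ ℤ.^ n ∣ (2ℤ ℤ.* y) ℤ.^ n
2^∣even^ zero    y = ∣-refl
2^∣even^ (suc n) y = *-mono-∣ {a = 2ℤ} (∣m⇒∣m*n y ∣-refl) (2^∣even^ n y)

-- The case r = 2

module _ (e n : ℕ) (6+e≤n : 6 + e ≤ n) where

  private
    -- Here m = 7 + e, so the period 2^(m-6) is `2 ^ suc e` and the bound m - 1 on `n` is `6 + e`.
    period : ℕ
    period = 2 ^ suc e

    difference : ℤ → ℤ
    difference x = x ℤ.^ (n + period) ℤ.* fall x 2 ℤ.- x ℤ.^ n ℤ.* fall x 2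

    difference-factor : ∀ t x →
      t ℤ.* difference x ≡ (t ℤ.* fall x 2) ℤ.* (x ℤ.^ period ℤ.- 1ℤ) ℤ.* x ℤ.^ n
    difference-factor t x = trans
      (cong (λ z → t ℤ.* (z ℤ.* fall x 2 ℤ.- x ℤ.^ n ℤ.* fall x 2)) (ℤ.^-distribˡ-+-* x n period))
      (eq t (x ℤ.^ n) (x ℤ.^ period) (fall x 2))
      where
      eq : ∀ t a b f → t ℤ.* (a ℤ.* b ℤ.* f ℤ.- a ℤ.* f) ≡ (t ℤ.* f) ℤ.* (b ℤ.- 1ℤ) ℤ.* a
      eq = ℤ.solve-∀

    -- The factor `x` of `fall x 2` raises `x ^ n` to `x ^ suc n`, and `7 + e ≤ suc n`.
    even-term : ∀ t x → (∃[ y ] x ≡ 2ℤ ℤ.* y) → 2ℤ ℤ.^ (7 + e) ∣ t ℤ.* difference x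
    even-term t x (y , refl) = subst (2ℤ ℤ.^ (7 + e) ∣_) (sym (trans (difference-factor t x) (eq t x (x ℤ.^ period) (x ℤ.^ n))))
      (∣n⇒∣m*n (t ℤ.* (x ℤ.- 1ℤ) ℤ.* (x ℤ.^ period ℤ.- 1ℤ)) (∣-trans (2^-mono-∣ (s≤s 6+e≤n)) (2^∣even^ (suc n) y)))
      where
      eq : ∀ t x p q →
        (t ℤ.* (1ℤ ℤ.* (x ℤ.- 0ℤ) ℤ.* (x ℤ.- 1ℤ))) ℤ.* (p ℤ.- 1ℤ) ℤ.* q ≡
        t ℤ.* (x ℤ.- 1ℤ) ℤ.* (p ℤ.- 1ℤ) ℤ.* (x ℤ.* q)
      eq = ℤ.solve-∀

    -- Four factors 2 come from the weighted falling factorial and `e + 3` from `odd-power`.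
    odd-term : ∀ t x → (∃[ y ] x ≡ 1ℤ ℤ.+ 2ℤ ℤ.* y) → 2ℤ ℤ.^ 4 ∣ t ℤ.* fall x 2 → 2ℤ ℤ.^ (7 + e) ∣ t ℤ.* difference x
    odd-term t x (y , refl) 16∣ = subst (2ℤ ℤ.^ (7 + e) ∣_) (sym (difference-factor t x))
      (∣m⇒∣m*n (x ℤ.^ n) (subst (_∣ t ℤ.* fall x 2 ℤ.* (x ℤ.^ period ℤ.- 1ℤ)) 2^-split (*-mono-∣ 16∣ (odd-power e y))))
      where
      2^-split : 2ℤ ℤ.^ 4 ℤ.* 2ℤ ℤ.^ (e + 3) ≡ 2ℤ ℤ.^ (7 + e)
      2^-split = trans (sym (ℤ.^-distribˡ-+-* 2ℤ 4 (e + 3))) (cong (λ k → 2ℤ ℤ.^ (4 + k)) (+-comm e 3))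

    minus-one-term : 2ℤ ℤ.^ (7 + e) ∣ 2ℤ ℤ.^ 0 ℤ.* difference -1ℤ
    minus-one-term = divides 0ℤ (trans (difference-factor 1ℤ -1ℤ)
      -- The constant 2 is `fall -1ℤ 2`; the term vanishes because the period is even.
      (cong (λ z → + 2 ℤ.* (z ℤ.- 1ℤ) ℤ.* -1ℤ ℤ.^ n) (trans (sym (ℤ.^-*-assoc -1ℤ 2 (2 ^ e))) (ℤ.^-zeroˡ (2 ^ e)))))

    term : ∀ j → 2ℤ ℤ.^ (7 + e) ∣ 2ℤ ℤ.^ j ℤ.* difference -[1+ j ]
    term 0 = minus-one-term
    term 1 = even-term (2ℤ ℤ.^ 1) (ℤ.- + 2) (-1ℤ , refl)
    -- At x = -3 the weighted falling factorial is 4 * 12 = 3 * 16.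
    term 2 = odd-term (2ℤ ℤ.^ 2) (ℤ.- + 3) (ℤ.- + 2 , refl) (divides (+ 3) refl)
    term 3 = even-term (2ℤ ℤ.^ 3) (ℤ.- + 4) (ℤ.- + 2 , refl)
    -- From here on the weight alone supplies the factor 16.
    term (suc (suc (suc (suc j)))) with parity -[1+ (4 + j) ]
    ... | inj₁ even = even-term (2ℤ ℤ.^ (4 + j)) -[1+ (4 + j) ] even
    ... | inj₂ odd  = odd-term (2ℤ ℤ.^ (4 + j)) -[1+ (4 + j) ] odd 
      (∣m⇒∣m*n (fall -[1+ (4 + j) ] 2) (2^-mono-∣ (m≤m+n 4 j)))

  -- Subtracting two instances of `fubini-weighted` leaves the weighted sum of `difference`, which
  -- `term` handles summand by summand.
  fubini-period-2 : 2ℤ ℤ.^ (7 + e) ∣ + fubini (n + period) 2 ℤ.- + fubini n 2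
  fubini-period-2 = subst (2ℤ ℤ.^ M ∣_)
    (trans (cong (λ w → (F′ ℤ.+ W′) ℤ.- (F ℤ.+ W) ℤ.- w) weighted-difference) (eq F′ F W′ W))
    (∣m∣n⇒∣m-n (∣m∣n⇒∣m-n (fubini-weighted M (n + period) 2) (fubini-weighted M n 2)) (weighted-∣ M term))
    where
    M  = 7 + e
    F′ = + fubini (n + period) 2
    F  = + fubini n 2
    h′ = λ x → x ℤ.^ (n + period) ℤ.* fall x 2
    h  = λ x → x ℤ.^ n ℤ.* fall x 2
    W′ = weighted M h′
    W  = weighted M h
    eq : ∀ f′ f w′ w → (f′ ℤ.+ w′) ℤ.- (f ℤ.+ w) ℤ.- (-1ℤ ℤ.* w ℤ.+ w′) ≡ f′ ℤ.- f
    eq = ℤ.solve-∀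
    swap-minus : ∀ a b → a ℤ.- b ≡ -1ℤ ℤ.* b ℤ.+ a
    swap-minus = ℤ.solve-∀
    weighted-difference : weighted M difference ≡ -1ℤ ℤ.* W ℤ.+ W′
    weighted-difference = trans (weighted-cong M (λ x → swap-minus (h′ x) (h x))) (weighted-linear M -1ℤ h h′)

-- From r = 2 to every larger r

-- Solving `fubini-suc` for the value at `3 + r` expresses it through the values at `2 + r` with
-- indices `suc n` and `n`, both within the bound.
fubini-period : ∀ e r n → 6 + e ≤ n → 2ℤ ℤ.^ (7 + e) ∣ + fubini (n + 2 ^ suc e) (2 + r) ℤ.- + fubini n (2 + r)
fubini-period e zero    n le = fubini-period-2 e n le
fubini-period e (suc r) n le = subst (2ℤ ℤ.^ (7 + e) ∣_) eq
  (∣m∣n⇒∣m-n (fubini-period e r (suc n) (m≤n⇒m≤1+n le)) (∣n⇒∣m*n (+ (2 + r)) (fubini-period e r n le)))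
  where
  F : ℕ → ℕ → ℤ
  F n r = + fubini n r
  n′ = n + 2 ^ suc e
  F-suc : ∀ n → F (suc n) (2 + r) ≡ + (2 + r) ℤ.* F n (2 + r) ℤ.+ F n (3 + r)
  F-suc n = trans (cong +_ (fubini-suc n (2 + r))) (cong (ℤ._+ F n (3 + r)) (ℤ.pos-* (2 + r) (fubini n (2 + r))))
  cancel : ∀ c a′ b′ a b → (c ℤ.* a′ ℤ.+ b′) ℤ.- (c ℤ.* a ℤ.+ b) ℤ.- c ℤ.* (a′ ℤ.- a) ≡ b′ ℤ.- b
  cancel = ℤ.solve-∀
  eq : F (suc n′) (2 + r) ℤ.- F (suc n) (2 + r) ℤ.- + (2 + r) ℤ.* (F n′ (2 + r) ℤ.- F n (2 + r)) ≡ F n′ (3 + r) ℤ.- F n (3 + r)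
  eq = trans
    (cong₂ (λ x y → x ℤ.- y ℤ.- + (2 + r) ℤ.* (F n′ (2 + r) ℤ.- F n (2 + r))) (F-suc n′) (F-suc n))
    (cancel (+ (2 + r)) (F n′ (2 + r)) (F n′ (3 + r)) (F n (2 + r)) (F n (3 + r)))

pos-2^ : ∀ m → 2ℤ ℤ.^ m ≡ + (2 ^ m)
pos-2^ zero    = refl
pos-2^ (suc m) = trans (cong (2ℤ ℤ.*_) (pos-2^ m)) (sym (ℤ.pos-* 2 (2 ^ m)))

theorem4p7 : ∀ (r m : ℕ) → 2 ≤ r → 7 ≤ m → ∀ (n : ℕ) → m ∸ 1 ≤ n →
    fubini (n + 2 ^ (m ∸ 6)) r ≡ fubini n r [mod 2 ^ m ]
-- Matching `m` as `7 + e` lets `m ∸ 1` and `m ∸ 6` reduce to `6 + e` and `suc e`.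
theorem4p7 (suc (suc r)) (suc (suc (suc (suc (suc (suc (suc e)))))))
  (s≤s (s≤s z≤n)) (s≤s (s≤s (s≤s (s≤s (s≤s (s≤s (s≤s z≤n))))))) n m∸1≤n =
  ∣⇒∣ᵤ (subst (_∣ + fubini (n + 2 ^ suc e) (2 + r) ℤ.- + fubini n (2 + r)) (pos-2^ (7 + e)) (fubini-period e r n m∸1≤n))
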